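{- Let $n\ge 1$ and let $T\in\mathcal{P}_n$ be a plane tree with $n$ edges. For any node $v$ of $T$, if $v\leadsto u$ (in $T$), then $$\mathsf{lev}_T(v)=\mathsf{lsw}_{\tilde\phi(T)}(u)\quad\text{and}\quad \mathsf{lsw}_T(v)=\mathsf{lev}_{\tilde\phi(T)}(u).$$ Moreover, $\mathsf{deg}_T(v)=\widetilde{\mathsf{deg}}_{\tilde\phi(T)}(u)$.
   Context: **Plane trees.** A plane tree is a rooted tree in which the children of each node are linearly ordered (from left to right). $\mathcal{P}_n$ is the set of plane trees with $n\ge1$ edges. A node without children is a leaf; otherwise it is internal. The nodes of $T\in\mathcal P_n$ are named $0,1,\dots,n$ (only to distinguish them), the root being $0$ and the leftmost child of the root being $1$. Nodes with the same parent are siblings; siblings to the left of a node are its elder siblings, those to the right its younger siblings. **Binary trees and the involution $\tilde\phi$.** A binary tree is a rooted tree in which each node has at most one left child and at most one right child; $\mathcal{B}_n$ is the set of binary trees with $n$ nodes. The bijection $\varphi:\mathcal P_n\to\mathcal B_n$: the nodes of $\varphi(T)$ are the non-root nodes of $T$; its root is the leftmost child of the root of $T$; for non-root nodes $x,y$ of $T$, $y$ is the left child of $x$ in $\varphi(T)$ iff $y$ is the leftmost child of $x$ in $T$, and $y$ is the right child of $x$ in $\varphi(T)$ iff $x$ is the closest elder sibling of $y$ in $T$. For $B\in\mathcal B_n$, $\phi(B)$ is the mirror image of $B$ (same nodes, left and right children exchanged). Put $\tilde\phi=\varphi^{ -1}\circ\phi\circ\varphi:\mathcal P_n\to\mathcal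 P_n$. Node names are kept, so $T$ and $\tilde\phi(T)$ have the same node set, both with root $0$. **Complement.** Let $T\in\mathcal P_n$ and $B=\varphi(T)$. Add new nodes to $B$ so that every node of $B$ has exactly two children; the resulting complete binary tree is the complement $\overline B$. The added nodes are named $0',1',\dots,n'$: if the added node is a left child of a node $v$ of $B$, it is named $v'$; if it is a right child of a node $v$ of $B$, it is named $u'$, where $u$ is the parent of $v$ in $T$. The complement $\overline{\phi(B)}$ is defined in the same way using the plane tree $\tilde\phi(T)$, for which $\varphi(\tilde\phi(T))=\phi(B)$. **The relation $\leadsto$.** For every node $v$ of $T$ there is a unique node $u$ of $T$ such that either $v'$ is the right child of $u$ in $\overline B$, or $u'$ is the right child of $v$ in $\overline{\phi(B)}$. One writes $v\leadsto u$. **Statistics of a node $v$ of $T$.** - $\mathsf{lev}_T(v)$ is the number of edges on the path from $v$ to the root. - $\mathsf{lsw}_T(v)$ (left spanning width) is the number of children of $v$ plus the number of edges attached to nodes other than $v$ on the path from $v$ to the root from the left-hand side of the path (equivalently, the number of children of $v$ plus the total number of elder siblings of the non-root nodes on the path from $v$ to the root, $v$ included). - $\mathsf{deg}_T(v)$ is the number of children of $v$. - The dual degree $\widetilde{\mathsf{deg}}_T(v)$ is: $0$ if $v$ is internal; $\mathsf{lev}_T(v)$ if $v$ is a leaf and no node on the path from $v$ to the root has elder siblings; otherwise, the number of nodes from $v$ to the first node having elder siblings (both included) when walking from $v$ to the root. -}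

module Defs where

open import Data.Bool.Base using (if_then_else_)
open import Data.Fin.Base using (Fin; zero; suc; toℕ)
open import Data.List.Base using (List; []; _∷_; _++_; _∷ʳ_; head; length; takeWhile; allFin; tabulate)
open import Data.List.Membership.Propositional using (_∈_)
open import Data.List.Membership.Propositional.Properties using (∈-++⁻; ∈-++⁺ˡ; ∈-++⁺ʳ; ∈-allFin; ∈-tabulate⁻)
open import Data.List.Properties using (++-assoc)
open import Data.List.Relation.Binary.Permutation.Propositional using (_↭_; ↭-refl; ↭-sym; ↭-trans; ↭-reflexive; prep)
open import Data.List.Relation.Binary.Permutation.Propositional.Properties using (∈-resp-↭; drop-∷; ++⁺; ++-comm)
open import Data.List.Relation.Unary.All using (all?)
open import Data.List.Relation.Unary.Any using (Any; here; there)
open import Data.List.Relation.Unary.Any.Properties using (++⁺ʳ)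
open import Data.Maybe.Base using (Maybe; just; nothing) renaming (map to mapᵐ)
open import Data.Nat.Base using (ℕ; zero; suc; _+_)
open import Data.Nat.Properties using (_≟_)
open import Data.Nat.ListAction using (sum)
open import Data.Product.Base using (∃-syntax; _×_; _,_; proj₁; proj₂)
open import Data.Sum.Base using (_⊎_; inj₁; inj₂)
open import Function.Base using (_∘_)
open import Function.Bundles using (_⇔_; mk⇔; Equivalence)
open import Relation.Binary.PropositionalEquality using (_≡_; _≢_; refl; sym; trans; cong; cong₂; subst)
open import Relation.Nullary.Decidable.Core using (⌊_⌋)
open import Relation.Nullary.Negation.Core using (contradiction)

data Tree (A : Set) : Set where
  node : A → List (Tree A) → Tree A

root : {A : Set} → Tree A → A
root (node x _) = x

children : {A : Set} → Tree A → List (Tree A)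
children (node _ ts) = ts

nodes  : {A : Set} → Tree A → List A
nodes* : {A : Set} → List (Tree A) → List A
nodes  (node x ts) = x ∷ nodes* ts
nodes* []          = []
nodes* (t ∷ ts)    = nodes t ++ nodes* ts

-- An element of s ⊑ t is an occurrence of s as a full subtree of t, i.e.
-- the path in t from the root of t to a node carrying the subtree s.
data _⊑_ {A : Set} (s : Tree A) : Tree A → Set where
  here  : s ⊑ s
  below : ∀ {x ts} → Any (s ⊑_) ts → s ⊑ node x ts

-- The node names are 0,…,n, each used exactly once; hence n + 1 nodes and
-- n edges.  The leftmost child of the root must exist, so the type is empty
-- for n = 0.
record PlaneTree (n : ℕ) : Set where
  field
    tree  : Tree (Fin (suc n))
    names : nodes tree ↭ allFin (suc n)
    root₀ : root tree ≡ zero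
    left₁ : mapᵐ (toℕ ∘ root) (head (children tree)) ≡ just 1

data BTree (A : Set) : Set where
  empty : BTree A
  bin   : A → (left right : BTree A) → BTree A

rootᵇ : {A : Set} → BTree A → Maybe A
rootᵇ empty       = nothing
rootᵇ (bin x _ _) = just x

nodesᵇ : {A : Set} → BTree A → List A
nodesᵇ empty       = []
nodesᵇ (bin x l r) = x ∷ nodesᵇ l ++ nodesᵇ r

data _⊑ᵇ_ {A : Set} (b : BTree A) : BTree A → Set where
  here  : b ⊑ᵇ b
  left  : ∀ {x l r} → b ⊑ᵇ l → b ⊑ᵇ bin x l r
  right : ∀ {x l r} → b ⊑ᵇ r → b ⊑ᵇ bin x l r

-- LeftChild B x y, RightChild B x y: y is the left (right) child of x in B.
LeftChild : {A : Set} → BTree A → A → A → Set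
LeftChild B x y = ∃[ l ] ∃[ r ] ∃[ c ] bin x (bin y l r) c ⊑ᵇ B

RightChild : {A : Set} → BTree A → A → A → Set
RightChild B x y = ∃[ c ] ∃[ l ] ∃[ r ] bin x c (bin y l r) ⊑ᵇ B

-- The binary trees that arise here have the nodes 1,…,n and root 1.
record BinaryTree (n : ℕ) : Set where
  field
    tree  : BTree (Fin (suc n))
    names : nodesᵇ tree ↭ tabulate suc
    root₁ : mapᵐ toℕ (rootᵇ tree) ≡ just 1

-- The bijection φ on the ordered forest of subtrees at the children of a
-- node.  That it matches the description by leftmost children and closest
-- elder siblings is proved below (φ-root, φ-left, φ-right).
φ* : {A : Set} → List (Tree A) → BTree A
φ* []               = empty
φ* (node x cs ∷ ts) = bin x (φ* cs) (φ* ts)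

φ*⁻¹ : {A : Set} → BTree A → List (Tree A)
φ*⁻¹ empty       = []
φ*⁻¹ (bin x l r) = node x (φ*⁻¹ l) ∷ φ*⁻¹ r

mirror* : {A : Set} → BTree A → BTree A
mirror* empty       = empty
mirror* (bin x l r) = bin x (mirror* r) (mirror* l)

nodes-φ* : {A : Set} (ts : List (Tree A)) → nodesᵇ (φ* ts) ≡ nodes* ts
nodes-φ* []               = refl
nodes-φ* (node x cs ∷ ts) = cong (x ∷_) (cong₂ _++_ (nodes-φ* cs) (nodes-φ* ts))

nodes-φ*⁻¹ : {A : Set} (b : BTree A) → nodes* (φ*⁻¹ b) ≡ nodesᵇ b
nodes-φ*⁻¹ empty       = refl
nodes-φ*⁻¹ (bin x l r) = cong (x ∷_) (cong₂ _++_ (nodes-φ*⁻¹ l) (nodes-φ*⁻¹ r))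

nodes-mirror* : {A : Set} (b : BTree A) → nodesᵇ (mirror* b) ↭ nodesᵇ b
nodes-mirror* empty       = ↭-refl
nodes-mirror* (bin x l r) =
  prep x (↭-trans (++-comm (nodesᵇ (mirror* r)) _) (++⁺ (nodes-mirror* l) (nodes-mirror* r)))

nonRoot-names : ∀ {n} (T : PlaneTree n) → nodes* (children (PlaneTree.tree T)) ↭ tabulate suc
nonRoot-names record { tree = node .zero ts ; names = p ; root₀ = refl } = drop-∷ p

φ : ∀ {n} → PlaneTree n → BinaryTree n
φ T = record
  { tree  = φ* ts
  ; names = ↭-trans (↭-reflexive (nodes-φ* ts)) (nonRoot-names T)
  ; root₁ = trans (root-φ* ts) left₁
  }
  where
  open PlaneTree T
  ts = children tree
  root-φ* : ∀ us → mapᵐ toℕ (rootᵇ (φ* us)) ≡ mapᵐ (toℕ ∘ root) (head us)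
  root-φ* []             = refl
  root-φ* (node x _ ∷ _) = refl

φ⁻¹ : ∀ {n} → BinaryTree n → PlaneTree n
φ⁻¹ B = record
  { tree  = node zero (φ*⁻¹ tree)
  ; names = prep zero (↭-trans (↭-reflexive (nodes-φ*⁻¹ tree)) names)
  ; root₀ = refl
  ; left₁ = trans (head-φ*⁻¹ tree) root₁
  }
  where
  open BinaryTree B
  head-φ*⁻¹ : ∀ b → mapᵐ (toℕ ∘ root) (head (φ*⁻¹ b)) ≡ mapᵐ toℕ (rootᵇ b)
  head-φ*⁻¹ empty       = refl
  head-φ*⁻¹ (bin _ _ _) = refl

mirror : ∀ {n} → BinaryTree n → BinaryTree n
mirror B = record
  { tree  = mirror* tree
  ; names = ↭-trans (nodes-mirror* tree) names
  ; root₁ = trans (root-mirror* tree) root₁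
  }
  where
  open BinaryTree B
  root-mirror* : ∀ b → mapᵐ toℕ (rootᵇ (mirror* b)) ≡ mapᵐ toℕ (rootᵇ b)
  root-mirror* empty       = refl
  root-mirror* (bin _ _ _) = refl

φ̃ : ∀ {n} → PlaneTree n → PlaneTree n
φ̃ = φ⁻¹ ∘ mirror ∘ φ

-- A node named v, together with the path from the root to it.
_∈ᵗ_ : {A : Set} → A → Tree A → Set
v ∈ᵗ t = ∃[ ts ] node v ts ⊑ t

locate′  : {A : Set} {v : A} (t : Tree A) → v ∈ nodes t → v ∈ᵗ t
locate*′ : {A : Set} {v : A} (ts : List (Tree A)) → v ∈ nodes* ts → ∃[ us ] Any (node v us ⊑_) ts
locate′ (node x ts) (here refl) = ts , here
locate′ (node x ts) (there i)   = let us , a = locate*′ ts i in us , below a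
locate*′ (t ∷ ts) i with ∈-++⁻ (nodes t) i
... | inj₁ j = let us , p = locate′ t j in us , here p
... | inj₂ j = let us , a = locate*′ ts j in us , there a

locate : ∀ {n} (T : PlaneTree n) (v : Fin (suc n)) → v ∈ᵗ PlaneTree.tree T
locate T v = locate′ tree (∈-resp-↭ (↭-sym names) (∈-allFin v))
  where open PlaneTree T

-- For the non-root nodes on the path, from the lower end up to the root:
-- their numbers of elder siblings.
eldersAt  : {A : Set} {s t : Tree A} → s ⊑ t → List ℕ
eldersAt* : {A : Set} {s : Tree A} {ts : List (Tree A)} → ℕ → Any (s ⊑_) ts → List ℕ
eldersAt here             = []
eldersAt (below a)        = eldersAt* 0 a
eldersAt* k (here p)      = eldersAt p ∷ʳ k
eldersAt* k (there a)     = eldersAt* (suc k) a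

-- The parent of the lower end of the path, or the first argument if the
-- path consists of the root only.
parentAt  : {A : Set} {s t : Tree A} → A → s ⊑ t → A
parentAt* : {A : Set} {s : Tree A} {ts : List (Tree A)} → A → Any (s ⊑_) ts → A
parentAt x here           = x
parentAt _ (below {x} a)  = parentAt* x a
parentAt* x (here p)      = parentAt x p
parentAt* x (there a)     = parentAt* x a

module _ {n : ℕ} (T : PlaneTree n) where
  open PlaneTree T

  elders : Fin (suc n) → List ℕ
  elders v = eldersAt (proj₂ (locate T v))

  -- The root is assigned itself; this value is never used, because the
  -- nodes of φ T are the non-root nodes of T.
  parent : Fin (suc n) → Fin (suc n)
  parent v = parentAt zero (proj₂ (locate T v))

  deg : Fin (suc n) → ℕ
  deg v = length (proj₁ (locate T v))

  lev : Fin (suc n) → ℕ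
  lev v = length (elders v)

  lsw : Fin (suc n) → ℕ
  lsw v = deg v + sum (elders v)

  dualDeg : Fin (suc n) → ℕ
  dualDeg v =
    if ⌊ deg v ≟ 0 ⌋
    then (if ⌊ all? (_≟ 0) (elders v) ⌋
          then lev v
          else suc (length (takeWhile (_≟ 0) (elders v))))
    else 0

-- inj₁ v is the node v of the given binary tree, inj₂ v the added node v′.
-- par is the parent function of the corresponding plane tree.
complete : {A : Set} → (par : A → A) → BTree A → BTree (A ⊎ A)
complete par empty       = empty
complete {A} par (bin v l r) = bin (inj₁ v) (fill v l) (fill (par v) r)
  where
  fill : A → BTree A → BTree (A ⊎ A)
  fill u empty           = bin (inj₂ u) empty empty
  fill u b@(bin _ _ _)   = complete par b

complement : ∀ {n} → PlaneTree n → BTree (Fin (suc n) ⊎ Fin (suc n))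
complement T = complete (parent T) (BinaryTree.tree (φ T))

-- The complement of the mirror image of φ T is complement (φ̃ T), since
-- φ (φ̃ T) is that mirror image (φ-φ̃ below).
_⊢_⇝_ : ∀ {n} → PlaneTree n → Fin (suc n) → Fin (suc n) → Set
T ⊢ v ⇝ u = RightChild (complement T) (inj₁ u) (inj₂ v)
          ⊎ RightChild (complement (φ̃ T)) (inj₁ v) (inj₂ u)

-- From here on: the constructions above have the properties that determine
-- them.

φ*-φ*⁻¹ : {A : Set} (b : BTree A) → φ* (φ*⁻¹ b) ≡ b
φ*-φ*⁻¹ empty       = refl
φ*-φ*⁻¹ (bin x l r) = cong₂ (bin x) (φ*-φ*⁻¹ l) (φ*-φ*⁻¹ r)

φ*⁻¹-φ* : {A : Set} (ts : List (Tree A)) → φ*⁻¹ (φ* ts) ≡ ts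
φ*⁻¹-φ* []               = refl
φ*⁻¹-φ* (node x cs ∷ ts) = cong₂ (λ us vs → node x us ∷ vs) (φ*⁻¹-φ* cs) (φ*⁻¹-φ* ts)

φ-φ⁻¹ : ∀ {n} (B : BinaryTree n) → BinaryTree.tree (φ (φ⁻¹ B)) ≡ BinaryTree.tree B
φ-φ⁻¹ B = φ*-φ*⁻¹ (BinaryTree.tree B)

φ⁻¹-φ : ∀ {n} (T : PlaneTree n) → PlaneTree.tree (φ⁻¹ (φ T)) ≡ PlaneTree.tree T
φ⁻¹-φ record { tree = node .zero ts ; root₀ = refl } = cong (node zero) (φ*⁻¹-φ* ts)

φ-φ̃ : ∀ {n} (T : PlaneTree n) → BinaryTree.tree (φ (φ̃ T)) ≡ BinaryTree.tree (mirror (φ T))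
φ-φ̃ T = φ-φ⁻¹ (mirror (φ T))

-- y is the leftmost child of x.
LeftmostChild : {A : Set} → Tree A → A → A → Set
LeftmostChild t x y = ∃[ us ] ∃[ vs ] node x (node y us ∷ vs) ⊑ t

-- x is the closest elder sibling of y.
ClosestElder : {A : Set} → Tree A → A → A → Set
ClosestElder t x y =
  ∃[ z ] ∃[ ss ] ∃[ us ] ∃[ vs ] ∃[ ws ] node z (ss ++ node x us ∷ node y vs ∷ ws) ⊑ t

⊑ᵇ-trans : {A : Set} {a b c : BTree A} → a ⊑ᵇ b → b ⊑ᵇ c → a ⊑ᵇ c
⊑ᵇ-trans p here      = p
⊑ᵇ-trans p (left q)  = left (⊑ᵇ-trans p q)
⊑ᵇ-trans p (right q) = right (⊑ᵇ-trans p q)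

φ*-suffix : {A : Set} (ss {ts} : List (Tree A)) → φ* ts ⊑ᵇ φ* (ss ++ ts)
φ*-suffix []               = here
φ*-suffix (node _ _ ∷ ss)  = right (φ*-suffix ss)

φ*-below : {A : Set} {x : A} {us ts : List (Tree A)} →
           Any (node x us ⊑_) ts → ∃[ r ] bin x (φ* us) r ⊑ᵇ φ* ts
φ*-below (here here)                   = _ , here
φ*-below {ts = node _ _ ∷ _} (here (below a)) = let r , p = φ*-below a in r , left p
φ*-below {ts = node _ _ ∷ _} (there a) = let r , p = φ*-below a in r , right p

φ*-children : {A : Set} {z w : A} {us ts : List (Tree A)} → node z us ⊑ node w ts → φ* us ⊑ᵇ φ* ts
φ*-children here      = here
φ*-children (below a) = let _ , p = φ*-below a in ⊑ᵇ-trans (left here) p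

φ*-occurs : {A : Set} {x : A} {l r : BTree A} (w : A) (ss ts : List (Tree A)) → bin x l r ⊑ᵇ φ* ts →
  ∃[ z ] ∃[ qs ] ∃[ us ] ∃[ vs ]
    node z (qs ++ node x us ∷ vs) ⊑ node w (ss ++ ts) × φ* us ≡ l × φ* vs ≡ r
φ*-occurs w ss (node x cs ∷ ts) here = w , ss , cs , ts , here , refl , refl
φ*-occurs w ss (node x cs ∷ ts) (left p) =
  let z , qs , us , vs , q , e = φ*-occurs x [] cs p
  in z , qs , us , vs , below (++⁺ʳ ss (here q)) , e
φ*-occurs w ss (t@(node _ _) ∷ ts) (right p) =
  let z , qs , us , vs , q , e = φ*-occurs w (ss ++ t ∷ []) ts p
  in z , qs , us , vs , subst (λ k → node z (qs ++ node _ us ∷ vs) ⊑ node w k) (++-assoc ss (t ∷ []) ts) q , e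

⊑⇒∈  : {A : Set} {x : A} {us : List (Tree A)} {t : Tree A} → node x us ⊑ t → x ∈ nodes t
⊑⇒∈* : {A : Set} {x : A} {us ts : List (Tree A)} → Any (node x us ⊑_) ts → x ∈ nodes* ts
⊑⇒∈ here                  = here refl
⊑⇒∈ (below a)             = there (⊑⇒∈* a)
⊑⇒∈* (here p)             = ∈-++⁺ˡ (⊑⇒∈ p)
⊑⇒∈* {ts = t ∷ _} (there a) = ∈-++⁺ʳ (nodes t) (⊑⇒∈* a)

⊑ᵇ⇒∈ : {A : Set} {x : A} {l r b : BTree A} → bin x l r ⊑ᵇ b → x ∈ nodesᵇ b
⊑ᵇ⇒∈ here                      = here refl
⊑ᵇ⇒∈ (left p)                  = there (∈-++⁺ˡ (⊑ᵇ⇒∈ p))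
⊑ᵇ⇒∈ (right {l = l} p)         = there (∈-++⁺ʳ (nodesᵇ l) (⊑ᵇ⇒∈ p))

child-⊑ : {A : Set} {z x : A} {us vs : List (Tree A)} (qs : List (Tree A)) {t : Tree A} →
          node z (qs ++ node x us ∷ vs) ⊑ t → node x us ⊑ t
child-⊑  qs here      = below (++⁺ʳ qs (here here))
child-⊑  qs (below a) = below (go a)
  where
  go : ∀ {ts} → Any (_ ⊑_) ts → Any (_ ⊑_) ts
  go (here p)  = here (child-⊑ qs p)
  go (there b) = there (go b)

module _ {n : ℕ} (T : PlaneTree n) where
  private
    t = PlaneTree.tree T
    B = BinaryTree.tree (φ T)

  φ-root : rootᵇ B ≡ mapᵐ root (head (children t))
  φ-root with children t
  ... | []           = refl
  ... | node _ _ ∷ _ = refl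

  φ-nodes : ∀ x → x ∈ nodesᵇ B ⇔ (x ≢ zero)
  φ-nodes x = mk⇔ to (from x)
    where
    to : x ∈ nodesᵇ B → x ≢ zero
    to i refl with ∈-tabulate⁻ (∈-resp-↭ (BinaryTree.names (φ T)) i)
    ... | _ , ()
    from : ∀ y → y ≢ zero → y ∈ nodesᵇ B
    from y y≢0 with ∈-allFin y
    ... | here y≡0 = contradiction y≡0 y≢0
    ... | there i  = ∈-resp-↭ (↭-sym (BinaryTree.names (φ T))) i

  φ-left : ∀ x y → LeftChild B x y ⇔ (x ≢ zero × LeftmostChild t x y)
  φ-left x y = mk⇔ to (from t (PlaneTree.root₀ T))
    where
    to : LeftChild B x y → x ≢ zero × LeftmostChild t x y
    to (l , r , c , p) = Equivalence.to (φ-nodes x) (⊑ᵇ⇒∈ p) , go t p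
      where
      go : ∀ s → bin x (bin y l r) c ⊑ᵇ φ* (children s) → LeftmostChild s x y
      go (node w ts) q with φ*-occurs w [] ts q
      ... | _ , qs , node .y us ∷ ws , _ , q′ , refl , _ = us , ws , child-⊑ qs q′
    from : ∀ s → root s ≡ zero → x ≢ zero × LeftmostChild s x y → LeftChild (φ* (children s)) x y
    from _ e (x≢0 , _ , _ , here)    = contradiction e x≢0
    from _ e (x≢0 , _ , _ , below a) = let r , p = φ*-below a in _ , _ , r , p

  φ-right : ∀ x y → RightChild B x y ⇔ ClosestElder t x y
  φ-right x y = mk⇔ (to t) (from t)
    where
    to : ∀ s → RightChild (φ* (children s)) x y → ClosestElder s x y
    to (node w ts) (_ , _ , _ , p) with φ*-occurs w [] ts p
    ... | z , qs , us , node .y vs ∷ ws , q , _ , refl = z , qs , us , vs , ws , q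
    from : ∀ s → ClosestElder s x y → RightChild (φ* (children s)) x y
    from (node _ _) (_ , ss , _ , _ , _ , p) = _ , _ , _ , ⊑ᵇ-trans (φ*-suffix ss) (φ*-children p)

{-# OPTIONS --safe #-}

-- A path from the root of φ T to a node determines the numbers of elder
-- siblings along the corresponding path in T: a left step starts a new level
-- with no elder sibling, a right step adds one elder sibling on the current
-- level.  Mirroring exchanges the two kinds of step, so that the lists of
-- elder numbers of a node in T and in φ̃ T are conjugate, much as partitions
-- are.  A relation v ⇝ u says that v is the parent of its last child u in T,
-- or that u is the parent of its last child v in φ̃ T; these cases are
-- exchanged by swapping T and φ̃ T, and in each the claim is a property of
-- conjugate lists.
module Submission where

open import Defs
open import Data.Bool.Base using (if_then_else_)
open import Data.Fin.Base using (Fin; zero)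
open import Data.List.Base using (List; []; _∷_; _++_; _∷ʳ_; length; takeWhile)
open import Data.List.Membership.Propositional.Properties using (∈-++⁺ʳ)
open import Data.List.Properties using (++-assoc; length-++)
open import Data.List.Relation.Binary.Disjoint.Propositional using (Disjoint)
open import Data.List.Relation.Binary.Permutation.Propositional using (↭-sym; ↭⇒↭ₛ)
open import Data.List.Relation.Binary.Permutation.Setoid.Properties using (Unique-resp-↭)
open import Data.List.Relation.Unary.All using (all?)
open import Data.List.Relation.Unary.All.Properties using (++⁻ˡ; All¬⇒¬Any)
open import Data.List.Relation.Unary.AllPairs using ([]; _∷_)
open import Data.List.Relation.Unary.Any using (Any; here; there)
open import Data.List.Relation.Unary.Any.Properties using (++⁺ʳ)
open import Data.List.Relation.Unary.Unique.Propositional using (Unique)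
open import Data.List.Relation.Unary.Unique.Propositional.Properties using (allFin⁺)
open import Data.Nat.Base using (ℕ; zero; suc; _+_; _≤_)
open import Data.Nat.ListAction using (sum)
open import Data.Nat.Properties using (_≟_; +-comm; +-identityʳ; +-suc)
open import Data.Product.Base using (∃-syntax; _×_; _,_; proj₁; proj₂; map₂)
open import Data.Sum.Base using (inj₁; inj₂)
open import Function.Base using (_∘_)
open import Relation.Binary.PropositionalEquality using (_≡_; refl; sym; trans; cong; cong₂)
open import Relation.Binary.PropositionalEquality.Properties using (setoid)
open import Relation.Nullary.Decidable.Core using (⌊_⌋; yes; no)
open import Relation.Nullary.Negation.Core using (contradiction)

private
  variable
    A : Set
    n : ℕ

Unique-++⁻ : (xs : List A) {ys : List A} → Unique (xs ++ ys) →
             Unique xs × Unique ys × Disjoint xs ys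
Unique-++⁻ []       u       = [] , u , λ ()
Unique-++⁻ (x ∷ xs) (p ∷ u) =
  let ux , uy , d = Unique-++⁻ xs u
  in ++⁻ˡ xs p ∷ ux , uy ,
     λ { (here refl , j) → All¬⇒¬Any p (∈-++⁺ʳ xs j)
       ; (there i   , j) → d (i , j) }

-- A second path would put the name both at the root and below it, or in two disjoint sibling
-- subtrees. Hence the path chosen by `locate` may be replaced by any path at hand.
occurrence-unique  : {v : A} {t : Tree A} → Unique (nodes t) → (p q : v ∈ᵗ t) → p ≡ q
occurrence-unique* : {v : A} {ts : List (Tree A)} → Unique (nodes* ts) →
                     (p q : ∃[ us ] Any (node v us ⊑_) ts) → p ≡ q
occurrence-unique _        (_ , here)    (_ , here)    = refl
occurrence-unique (x∉ ∷ _) (_ , here)    (_ , below b) = contradiction (⊑⇒∈* b) (All¬⇒¬Any x∉)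
occurrence-unique (x∉ ∷ _) (_ , below a) (_ , here)    = contradiction (⊑⇒∈* a) (All¬⇒¬Any x∉)
occurrence-unique (_ ∷ u)  (_ , below a) (_ , below b) =
  cong (map₂ below) (occurrence-unique* u (_ , a) (_ , b))
occurrence-unique* {ts = t ∷ _} u (_ , a) (_ , b) with Unique-++⁻ (nodes t) u | a | b
... | ut , _ , _ | here p  | here q  = cong (map₂ here) (occurrence-unique ut (_ , p) (_ , q))
... | _ , _ , d  | here p  | there b = contradiction (⊑⇒∈ p , ⊑⇒∈* b) d
... | _ , _ , d  | there a | here q  = contradiction (⊑⇒∈ q , ⊑⇒∈* a) d
... | _ , us , _ | there a | there b = cong (map₂ there) (occurrence-unique* us (_ , a) (_ , b))

locate-≡ : (T : PlaneTree n) {v : Fin (suc n)} (p : v ∈ᵗ PlaneTree.tree T) → locate T v ≡ p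
locate-≡ {n} T = occurrence-unique (Unique-resp-↭ (setoid _) (↭⇒↭ₛ (↭-sym names)) (allFin⁺ (suc n))) _
  where open PlaneTree T

eldersAt*-++⁺ʳ : {s : Tree A} (k : ℕ) (ss : List (Tree A)) {ts : List (Tree A)} (a : Any (s ⊑_) ts) →
                 eldersAt* k (++⁺ʳ ss a) ≡ eldersAt* (length ss + k) a
eldersAt*-++⁺ʳ k []       a = refl
eldersAt*-++⁺ʳ k (_ ∷ ss) a =
  trans (eldersAt*-++⁺ʳ (suc k) ss a) (cong (λ m → eldersAt* m a) (+-suc (length ss) k))

parentAt*-++⁺ʳ : {s : Tree A} (x : A) (ss : List (Tree A)) {ts : List (Tree A)} (a : Any (s ⊑_) ts) →
                 parentAt* x (++⁺ʳ ss a) ≡ parentAt* x a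
parentAt*-++⁺ʳ x []       a = refl
parentAt*-++⁺ʳ x (_ ∷ ss) a = parentAt*-++⁺ʳ x ss a

-- The default `x` is quantified because the recursion through `below` replaces it at every level.
child  : {z : A} (ss : List (Tree A)) {s : Tree A} {ts : List (Tree A)} {t : Tree A}
         (p : node z (ss ++ s ∷ ts) ⊑ t) →
         ∃[ q ] eldersAt {s = s} {t} q ≡ length ss ∷ eldersAt p × (∀ x → parentAt x q ≡ z)
child* : {z : A} (ss : List (Tree A)) {s : Tree A} {ts us : List (Tree A)} (k : ℕ)
         (a : Any (node z (ss ++ s ∷ ts) ⊑_) us) →
         ∃[ b ] eldersAt* {s = s} {us} k b ≡ length ss ∷ eldersAt* k a × (∀ x → parentAt* x b ≡ z)
child ss here =
  below (++⁺ʳ ss (here here)) ,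
  trans (eldersAt*-++⁺ʳ 0 ss (here here)) (cong (_∷ []) (+-identityʳ (length ss))) ,
  λ _ → parentAt*-++⁺ʳ _ ss (here here)
child ss (below a) = let b , e , f = child* ss 0 a in below b , e , λ _ → f _
child* ss k (here p)  = let q , e , f = child ss p in here q , cong (_∷ʳ k) e , f
child* ss k (there a) = let b , e , f = child* ss (suc k) a in there b , e , f

-- A position in t in front of the final segment ts of a list of siblings:
-- k counts the siblings before it, ks lists the elder numbers of their parent.
record Context (t : Tree A) (ts : List (Tree A)) (k : ℕ) (ks : List ℕ) : Set where
  constructor context
  field
    {above}    : A
    {siblings} : List (Tree A)
    before     : List (Tree A)
    split      : siblings ≡ before ++ ts
    occurs     : node above siblings ⊑ t
    k-elders   : length before ≡ k
    ks-elders  : eldersAt occurs ≡ ks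

-- `descend` and `advance` mirror a left and a right step in the binary tree.
descend : ∀ {t : Tree A} {x us ts k ks} → Context t (node x us ∷ ts) k ks → Context t us 0 (k ∷ ks)
descend (context ss refl p refl refl) = let q , e , _ = child ss p in context [] refl q refl e

advance : ∀ {t : Tree A} {s ts k ks} → Context t (s ∷ ts) k ks → Context t ts (suc k) ks
advance {s = s} {ts} (context ss refl p refl refl) =
  context (ss ++ s ∷ []) (sym (++-assoc ss (s ∷ []) ts)) p
    (trans (length-++ ss) (+-comm (length ss) 1)) refl

-- A derivation is the word of steps leading to a node, read in two trees at once: `left` descends
-- in the first and advances in the second, `right` the reverse.
data Conjugate : ℕ → List ℕ → ℕ → List ℕ → Set where
  start : Conjugate 0 [] 0 []
  left  : ∀ {k ks m ms} → Conjugate k ks m ms → Conjugate 0 (k ∷ ks) (suc m) ms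
  right : ∀ {k ks m ms} → Conjugate k ks m ms → Conjugate (suc k) ks 0 (m ∷ ms)

-- Both sides count the `left` steps.
Conjugate-length : ∀ {k ks m ms} → Conjugate k ks m ms → length ks ≡ m + sum ms
Conjugate-length start     = refl
Conjugate-length (left c)  = cong suc (Conjugate-length c)
Conjugate-length (right c) = Conjugate-length c

-- Both sides count the `right` steps.
Conjugate-sum : ∀ {k ks m ms} → Conjugate k ks m ms → k + sum ks ≡ length ms
Conjugate-sum start     = refl
Conjugate-sum (left c)  = Conjugate-sum c
Conjugate-sum (right c) = cong suc (Conjugate-sum c)

leafDualDeg : List ℕ → ℕ
leafDualDeg ks =
  if ⌊ all? (_≟ 0) ks ⌋ then length ks else suc (length (takeWhile (_≟ 0) ks))

leafDualDeg-0∷ : (ks : List ℕ) → leafDualDeg (0 ∷ ks) ≡ suc (leafDualDeg ks)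
leafDualDeg-0∷ ks with all? (_≟ 0) ks
... | yes _ = refl
... | no _  = refl

-- The final run of `k` `right` steps gives `k` leading zeros in `m ∷ ms`. The entry after them is
-- nonzero if a `left` step precedes the run; otherwise it is the zero of `start` and ends the list.
-- Either way it adds one.
Conjugate-dualDeg : ∀ {k ks m ms} → Conjugate k ks m ms → suc k ≡ leafDualDeg (m ∷ ms)
Conjugate-dualDeg start     = refl
Conjugate-dualDeg (left c)  = refl
Conjugate-dualDeg (right c) = trans (cong suc (Conjugate-dualDeg c)) (sym (leafDualDeg-0∷ _))

-- Since `mirror*` swaps subtrees, each step descends in one plane tree and advances in the other,
-- as `Conjugate` records.
follow : ∀ {b : BTree A} {x l r t t′ k ks m ms} → bin x l r ⊑ᵇ b → Conjugate k ks m ms →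
  Context t (φ*⁻¹ b) k ks → Context t′ (φ*⁻¹ (mirror* b)) m ms →
  ∃[ k ] ∃[ ks ] ∃[ m ] ∃[ ms ] Conjugate k ks m ms ×
    Context t (φ*⁻¹ (bin x l r)) k ks × Context t′ (φ*⁻¹ (mirror* (bin x l r))) m ms
follow here      c d d′ = _ , _ , _ , _ , c , d , d′
follow (left p)  c d d′ = follow p (left c) (descend d) (advance d′)
follow (right p) c d d′ = follow p (right c) (advance d) (descend d′)

initial : (T : PlaneTree n) {b : BTree (Fin (suc n))} → BinaryTree.tree (φ T) ≡ b →
          Context (PlaneTree.tree T) (φ*⁻¹ b) 0 []
initial record { tree = node .zero ts ; root₀ = refl } refl =
  context [] (sym (φ*⁻¹-φ* ts)) here refl refl

module _ {A : Set} (par : A → A) where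

  -- An added right child fills an empty right subtree; the absurd cases look for an original node
  -- below an added one.
  complete-right : ∀ {v u c d e} (b : BTree A) →
    bin (inj₁ v) c (bin (inj₂ u) d e) ⊑ᵇ complete par b → ∃[ l ] bin v l empty ⊑ᵇ b × u ≡ par v
  complete-right (bin x l empty)                 here      = l , here , refl
  complete-right (bin x empty _)                 (left (left ()))
  complete-right (bin x empty _)                 (left (right ()))
  complete-right (bin x l@(bin _ _ _) _)         (left p)  =
    let l′ , q , e = complete-right l p in l′ , left q , e
  complete-right (bin x _ empty)                 (right (left ()))
  complete-right (bin x _ empty)                 (right (right ()))
  complete-right (bin x _ r@(bin _ _ _))         (right p) =
    let l′ , q , e = complete-right r p in l′ , right q , e

stats : (T : PlaneTree n) → ∀ {x us ts k ks} (c : Context (PlaneTree.tree T) (node x us ∷ ts) k ks) →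
  deg T x ≡ length us × elders T x ≡ k ∷ ks × parent T x ≡ Context.above c ×
  deg T (Context.above c) ≡ k + suc (length ts) × elders T (Context.above c) ≡ ks
stats T {us = us} (context ss refl p refl refl) with q , e , f ← child ss p =
    cong (length ∘ proj₁) (locate-≡ T (us , q))
  , trans (cong (eldersAt ∘ proj₂) (locate-≡ T (us , q))) e
  , trans (cong (parentAt zero ∘ proj₂) (locate-≡ T (us , q))) (f zero)
  , trans (cong (length ∘ proj₁) (locate-≡ T (_ , p))) (length-++ ss)
  , cong (eldersAt ∘ proj₂) (locate-≡ T (_ , p))

dualDeg-leaf : (T : PlaneTree n) {x : Fin (suc n)} {ks : List ℕ} → deg T x ≡ 0 → elders T x ≡ ks →
               dualDeg T x ≡ leafDualDeg ks
dualDeg-leaf T d refl rewrite d = refl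

dualDeg-internal : (T : PlaneTree n) {x : Fin (suc n)} {k : ℕ} → deg T x ≡ suc k → dualDeg T x ≡ 0
dualDeg-internal T d rewrite d = refl

-- With no right child, `u` is the last child of `v` in `T`; mirrored, it has no left child and is a
-- leaf of `T′`. Only the binary tree of `T′` is prescribed, so that `T` and `φ̃ T` can change
-- roles; the last two conjuncts serve that case.
last-child : (T T′ : PlaneTree n) {u : Fin (suc n)} {l : BTree (Fin (suc n))} →
  BinaryTree.tree (φ T′) ≡ mirror* (BinaryTree.tree (φ T)) →
  bin u l empty ⊑ᵇ BinaryTree.tree (φ T) → let v = parent T u in
  (lev T v ≡ lsw T′ u) × (lsw T v ≡ lev T′ u) × (deg T v ≡ dualDeg T′ u) ×
  (deg T′ u ≡ 0) × (dualDeg T v ≡ 0)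
last-child T T′ e p
  with k , _ , _ , _ , c , d , d′ ← follow p start (initial T refl) (initial T′ e)
  with _ , _ , pa , dv , ev ← stats T d
  with du , eu , _ ← stats T′ d′
  rewrite pa =
    trans (cong length ev) (trans (Conjugate-length c) (sym (cong₂ _+_ du (cong sum eu))))
  , trans (cong₂ _+_ dv′ (cong sum ev)) (trans (cong suc (Conjugate-sum c)) (sym (cong length eu)))
  , trans dv′ (trans (Conjugate-dualDeg c) (sym (dualDeg-leaf T′ du eu)))
  , du
  , dualDeg-internal T dv′
  where
  -- The children of `v` are the `k` elder siblings of `u` and `u` itself.
  dv′ = trans dv (+-comm k 1)

mirror*-involutive : (b : BTree A) → mirror* (mirror* b) ≡ b
mirror*-involutive empty       = refl
mirror*-involutive (bin x l r) = cong₂ (bin x) (mirror*-involutive l) (mirror*-involutive r)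

theorem2p2 : (n : ℕ) → 1 ≤ n → (T : PlaneTree n) (v u : Fin (suc n)) → T ⊢ v ⇝ u →
    (lev T v ≡ lsw (φ̃ T) u) × (lsw T v ≡ lev (φ̃ T) u) × (deg T v ≡ dualDeg (φ̃ T) u)
theorem2p2 n _ T v u (inj₁ (_ , _ , _ , p))
  with _ , q , refl ← complete-right (parent T) (BinaryTree.tree (φ T)) p =
  let lev≡ , lsw≡ , deg≡ , _ = last-child T (φ̃ T) (φ-φ̃ T) q in lev≡ , lsw≡ , deg≡
theorem2p2 n _ T v u (inj₂ (_ , _ , _ , p))
  with _ , q , refl ← complete-right (parent (φ̃ T)) (BinaryTree.tree (φ (φ̃ T))) p =
  -- Here `v` is a leaf of `T` and `u` is internal in `φ̃ T`, so both sides of the degree claim are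
  -- 0.
  let lev≡ , lsw≡ , _ , deg≡0 , dualDeg≡0 = last-child (φ̃ T) T φ-T q
  in sym lsw≡ , sym lev≡ , trans deg≡0 (sym dualDeg≡0)
  where
  φ-T : BinaryTree.tree (φ T) ≡ mirror* (BinaryTree.tree (φ (φ̃ T)))
  φ-T = sym (trans (cong mirror* (φ-φ̃ T)) (mirror*-involutive _))
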